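{- Let $(P_1(x,n))_{n\ge 0}$ and $(P_2(x,n))_{n\ge 0}$ be two sequences of polynomials in $x$ such that $P_k(x,n)$ has degree exactly $n$ for all $n\ge 0$ and $k\in\{1,2\}$. Let $k,h\in\{1,2\}$ with $k\ne h$, and let $n\ge 0$ be an integer. Put $B_{h,n}=\sum_{m=0}^n D_{h,n}^m$. Then $$B_{h,n}=\sum_{j=0}^n\left[\sum_{m=0}^nL_{k,h,j}^m\right]D_{k,n}^j,$$ where $D_{k,n}^j$ are the generalized Stirling numbers of the second kind and $L_{k,h,j}^m$ the generalized Lah numbers associated with the two polynomial sequences.
   Context: For $k\in\{1,2\}$, the generalized Stirling numbers of the second kind $D_{k,n}^j$ ($0\le j\le n$) are the coefficients in the polynomial identity $x^n=\sum_{j=0}^nD_{k,n}^jP_k(x,j)$. For $k\neq h$ in $\{1,2\}$, the generalized Lah numbers $L_{k,h,n}^j$ ($0\le j\le n$) are the coefficients in the polynomial identity $P_k(x,n)=\sum_{j=0}^nL_{k,h,n}^jP_h(x,j)$. By convention $L_{k,h,n}^j=0$ for $j>n$. Polynomials have coefficients in a field of characteristic zero (e.g. the real or complex numbers). -}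

module Defs where

open import Algebra.Apartness.Bundles using (HeytingField; HeytingCommutativeRing)
open import Algebra.Bundles using (CommutativeRing; RawMonoid)
import Algebra.Definitions.RawMonoid as RawMonoidDefs
import Algebra.Properties.Ring as RingProperties
import Algebra.Properties.Semiring.Mult as SemiringMult
import Algebra.Properties.Semiring.Sum as SemiringSum
open import Data.Fin.Base using (Fin; zero; suc; toℕ; fromℕ; inject₁)
open import Data.Fin.Properties using (toℕ-fromℕ; toℕ-inject₁; toℕ<n)
open import Data.List.Base using (List; []; _∷_; map)
open import Data.Nat.Base using (ℕ; zero; suc; _≤_; _<_; z≤n; s≤s)
open import Data.Nat.Properties using (_≟_; <⇒≢; <⇒≤; ≤∧≢⇒<)
open import Data.Product.Base using (Σ-syntax; ∃-syntax; _×_; _,_; proj₁; proj₂)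
open import Data.Vec.Functional using (Vector)
open import Function.Base using (_∘_)
open import Level using (Level; _⊔_)
import Relation.Binary.PropositionalEquality.Core as ≡
open import Relation.Binary.PropositionalEquality.Core using (_≡_)
import Relation.Binary.Reasoning.Setoid as SetoidReasoning
open import Relation.Nullary.Decidable.Core using (yes; no)
open import Relation.Nullary.Negation.Core using (contradiction)

-- "Nonzero" is read as "apart from 0#", as in any Heyting field; a field with
-- decidable equality is the special case where _#_ is the negation of _≈_.
module Polynomials {c ℓ₁ ℓ₂ : Level} (F : HeytingField c ℓ₁ ℓ₂) where

  open HeytingField F using (heytingCommutativeRing; #⇒invertible)
  open CommutativeRing (HeytingCommutativeRing.commutativeRing heytingCommutativeRing)
    hiding (zero) public
  open HeytingField F using (_#_) public
  open SemiringSum semiring using (sum; sum-syntax; sum⁺-syntax) public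
  open SemiringMult semiring using () renaming (_×_ to _ℕ×_)

  CharacteristicZero : Set ℓ₂
  CharacteristicZero = ∀ n → (suc n ℕ× 1#) # 0#

  -- Coefficients in increasing degree.  Trailing zeros are allowed, so
  -- equality of polynomials is _≈ₚ_.
  Polynomial : Set c
  Polynomial = List Carrier

  coeff : Polynomial → ℕ → Carrier
  coeff []      _       = 0#
  coeff (a ∷ p) zero    = a
  coeff (a ∷ p) (suc i) = coeff p i

  infix 4 _≈ₚ_
  infixl 6 _+ₚ_
  infixr 7 _·ₚ_

  _≈ₚ_ : Polynomial → Polynomial → Set ℓ₁
  p ≈ₚ q = ∀ i → coeff p i ≈ coeff q i

  _+ₚ_ : Polynomial → Polynomial → Polynomial
  []      +ₚ q       = q
  (a ∷ p) +ₚ []      = a ∷ p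
  (a ∷ p) +ₚ (b ∷ q) = (a + b) ∷ (p +ₚ q)

  _·ₚ_ : Carrier → Polynomial → Polynomial
  a ·ₚ p = map (a *_) p

  X^_ : ℕ → Polynomial
  X^ zero  = 1# ∷ []
  X^ suc n = 0# ∷ (X^ n)

  +ₚ-rawMonoid : RawMonoid c ℓ₁
  +ₚ-rawMonoid = record { _≈_ = _≈ₚ_ ; _∙_ = _+ₚ_ ; ε = [] }

  sumₚ⁺-syntax : ∀ n → Vector Polynomial (suc n) → Polynomial
  sumₚ⁺-syntax n = RawMonoidDefs.sum +ₚ-rawMonoid

  infixl 10 sumₚ⁺-syntax
  syntax sumₚ⁺-syntax n (λ j → p) = ∑ₚ[ j ≤ n ] p

  HasDegree : Polynomial → ℕ → Set (ℓ₁ ⊔ ℓ₂)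
  HasDegree p n = (coeff p n # 0#) × (∀ {i} → n < i → coeff p i ≈ 0#)

  -- D n j, for 0 ≤ j ≤ n, is the coefficient usually written D_n^j.
  IsStirling₂ : (ℕ → Polynomial) → (∀ n → Vector Carrier (suc n)) → Set ℓ₁
  IsStirling₂ P D = ∀ n → X^ n ≈ₚ ∑ₚ[ j ≤ n ] (D n j ·ₚ P (toℕ j))

  -- L n j is the coefficient usually written L_n^j; unlike for D, the index j
  -- ranges over all of ℕ, with the convention L_n^j = 0 for j > n.
  IsLah : (P Q : ℕ → Polynomial) → (ℕ → ℕ → Carrier) → Set ℓ₁
  IsLah P Q L =
    (∀ n → P n ≈ₚ ∑ₚ[ j ≤ n ] (L n (toℕ j) ·ₚ Q (toℕ j))) ×
    (∀ {n j} → n < j → L n j ≈ 0#)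

  -- The rest shows that a sequence with deg P n = n always has such
  -- coefficients, so that IsStirling₂ and IsLah are satisfiable.

  private
    open SemiringSum semiring using (sum-init-last; sum-cong-≋)
    open RingProperties ring using (-0#≈0#; -‿distribˡ-*)
    open SetoidReasoning setoid

    sumₚ : ∀ {n} → Vector Polynomial n → Polynomial
    sumₚ = RawMonoidDefs.sum +ₚ-rawMonoid

    coeff-+ : ∀ p q i → coeff (p +ₚ q) i ≈ coeff p i + coeff q i
    coeff-+ []      q       i       = sym (+-identityˡ _)
    coeff-+ (a ∷ p) []      i       = sym (+-identityʳ _)
    coeff-+ (a ∷ p) (b ∷ q) zero    = refl
    coeff-+ (a ∷ p) (b ∷ q) (suc i) = coeff-+ p q i

    coeff-· : ∀ a p i → coeff (a ·ₚ p) i ≈ a * coeff p i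
    coeff-· a []      i       = sym (zeroʳ a)
    coeff-· a (b ∷ p) zero    = refl
    coeff-· a (b ∷ p) (suc i) = coeff-· a p i

    coeff-sum : ∀ {n} (f : Vector Polynomial n) i →
                coeff (sumₚ f) i ≈ sum (λ j → coeff (f j) i)
    coeff-sum {zero}  f i = refl
    coeff-sum {suc n} f i =
      trans (coeff-+ (f zero) _ i) (+-congˡ (coeff-sum (f ∘ suc) i))

    coeff-X^ : ∀ n {i} → n < i → coeff (X^ n) i ≈ 0#
    coeff-X^ zero    {suc i} _         = refl
    coeff-X^ (suc n) {suc i} (s≤s n<i) = coeff-X^ n n<i

    _[_≔_] : (ℕ → Carrier) → ℕ → Carrier → ℕ → Carrier
    (f [ n ≔ a ]) j with j ≟ n
    ... | yes _ = a
    ... | no  _ = f j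

    ≔-here : ∀ f n a → (f [ n ≔ a ]) n ≡ a
    ≔-here f n a with n ≟ n
    ... | yes _  = ≡.refl
    ... | no n≢n = contradiction ≡.refl n≢n

    ≔-below : ∀ f {n a j} → j < n → (f [ n ≔ a ]) j ≡ f j
    ≔-below f {n} {a} {j} j<n with j ≟ n
    ... | yes j≡n = contradiction j≡n (<⇒≢ j<n)
    ... | no  _   = ≡.refl

    ≔-above : ∀ f {n a j} → n < j → (f [ n ≔ a ]) j ≡ f j
    ≔-above f {n} {a} {j} n<j with j ≟ n
    ... | yes j≡n = contradiction (≡.sym j≡n) (<⇒≢ n<j)
    ... | no  _   = ≡.refl

    x-0≈x : ∀ x → x - 0# ≈ x
    x-0≈x x = trans (+-congˡ -0#≈0#) (+-identityʳ x)

    Expansion : (ℕ → Polynomial) → ℕ → Polynomial → Set (c ⊔ ℓ₁)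
    Expansion P n q = Σ[ f ∈ (ℕ → Carrier) ]
      (∀ i → coeff q i ≈ sum {n} (λ j → f (toℕ j) * coeff (P (toℕ j)) i)) ×
      (∀ {j} → n ≤ j → f j ≈ 0#)

    -- Clearing coefficients from the top degree downwards.
    expand : ∀ P → (∀ n → HasDegree (P n) n) → ∀ n q →
             (∀ {i} → n ≤ i → coeff q i ≈ 0#) → Expansion P n q
    expand P deg zero q q<n = (λ _ → 0#) , (λ i → q<n z≤n) , (λ _ → refl)
    expand P deg (suc n) q q<1+n = f [ n ≔ a ] , eq , vanish
      where
      inverse = #⇒invertible (proj₁ (deg n))
      a = coeff q n * proj₁ inverse
      r = q +ₚ ((- a) ·ₚ P n)

      aP≈q : a * coeff (P n) n ≈ coeff q n
      aP≈q = begin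
        coeff q n * proj₁ inverse * coeff (P n) n          ≈⟨ *-assoc _ _ _ ⟩
        coeff q n * (proj₁ inverse * coeff (P n) n)        ≈⟨ *-congˡ (*-congˡ (x-0≈x _)) ⟨
        coeff q n * (proj₁ inverse * (coeff (P n) n - 0#)) ≈⟨ *-congˡ (proj₁ (proj₂ inverse)) ⟩
        coeff q n * 1#                                     ≈⟨ *-identityʳ _ ⟩
        coeff q n                                          ∎

      coeff-r : ∀ i → coeff r i ≈ coeff q i - a * coeff (P n) i
      coeff-r i = begin
        coeff r i                                ≈⟨ coeff-+ q _ i ⟩
        coeff q i + coeff ((- a) ·ₚ P n) i       ≈⟨ +-congˡ (coeff-· (- a) (P n) i) ⟩
        coeff q i + (- a) * coeff (P n) i        ≈⟨ +-congˡ (-‿distribˡ-* a _) ⟨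
        coeff q i - a * coeff (P n) i            ∎

      r<n : ∀ {i} → n ≤ i → coeff r i ≈ 0#
      r<n {i} n≤i with i ≟ n
      ... | yes ≡.refl = begin
        coeff r n                        ≈⟨ coeff-r n ⟩
        coeff q n - a * coeff (P n) n    ≈⟨ +-congˡ (-‿cong aP≈q) ⟩
        coeff q n - coeff q n            ≈⟨ -‿inverseʳ _ ⟩
        0#                               ∎
      ... | no i≢n = begin
        coeff r i                        ≈⟨ coeff-r i ⟩
        coeff q i - a * coeff (P n) i    ≈⟨ +-cong (q<1+n n<i) (-‿cong (trans (*-congˡ (proj₂ (deg n) n<i)) (zeroʳ a))) ⟩
        0# - 0#                          ≈⟨ x-0≈x 0# ⟩
        0#                               ∎
        where n<i = ≤∧≢⇒< n≤i (i≢n ∘ ≡.sym)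

      rec = expand P deg n r r<n
      f = proj₁ rec

      eq : ∀ i → coeff q i ≈ sum {suc n} (λ j → (f [ n ≔ a ]) (toℕ j) * coeff (P (toℕ j)) i)
      eq i = begin
        coeff q i                                                  ≈⟨ +-identityʳ _ ⟨
        coeff q i + 0#                                             ≈⟨ +-congˡ (-‿inverseˡ _) ⟨
        coeff q i + (- (a * coeff (P n) i) + a * coeff (P n) i)    ≈⟨ +-assoc _ _ _ ⟨
        coeff q i - a * coeff (P n) i + a * coeff (P n) i          ≈⟨ +-congʳ (coeff-r i) ⟨
        coeff r i + a * coeff (P n) i                              ≈⟨ +-cong (proj₁ (proj₂ rec) i) top ⟩
        sum {n} (λ j → f (toℕ j) * coeff (P (toℕ j)) i) + t (fromℕ n) ≈⟨ +-congʳ (sum-cong-≋ below) ⟩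
        sum {n} (λ j → t (inject₁ j)) + t (fromℕ n)                ≈⟨ sum-init-last t ⟨
        sum t                                                      ∎
        where
        t : Vector Carrier (suc n)
        t j = (f [ n ≔ a ]) (toℕ j) * coeff (P (toℕ j)) i

        top : a * coeff (P n) i ≈ t (fromℕ n)
        top = reflexive (≡.trans
          (≡.cong (_* coeff (P n) i) (≡.sym (≔-here f n a)))
          (≡.cong (λ k → (f [ n ≔ a ]) k * coeff (P k) i) (≡.sym (toℕ-fromℕ n))))

        below : ∀ j → f (toℕ j) * coeff (P (toℕ j)) i ≈ t (inject₁ j)
        below j = reflexive (≡.trans
          (≡.cong (_* coeff (P (toℕ j)) i) (≡.sym (≔-below f (toℕ<n j))))
          (≡.cong (λ k → (f [ n ≔ a ]) k * coeff (P k) i) (≡.sym (toℕ-inject₁ j))))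

      vanish : ∀ {j} → n < j → (f [ n ≔ a ]) j ≈ 0#
      vanish n<j = trans (reflexive (≔-above f n<j)) (proj₂ (proj₂ rec) (<⇒≤ n<j))

    expansion⇒≈ₚ : ∀ P n q ((f , _) : Expansion P (suc n) q) →
                   q ≈ₚ ∑ₚ[ j ≤ n ] (f (toℕ j) ·ₚ P (toℕ j))
    expansion⇒≈ₚ P n q (f , eq , _) i = trans (eq i) (sym (trans
      (coeff-sum (λ (j : Fin (suc n)) → f (toℕ j) ·ₚ P (toℕ j)) i)
      (sum-cong-≋ {suc n} (λ j → coeff-· (f (toℕ j)) (P (toℕ j)) i))))

  stirling₂-exists : ∀ P → (∀ n → HasDegree (P n) n) → ∃[ D ] IsStirling₂ P D
  stirling₂-exists P deg = (λ n → proj₁ (e n) ∘ toℕ) , (λ n → expansion⇒≈ₚ P n (X^ n) (e n))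
    where
    e : ∀ n → Expansion P (suc n) (X^ n)
    e n = expand P deg (suc n) (X^ n) (coeff-X^ n)

  lah-exists : ∀ P Q → (∀ n → HasDegree (P n) n) → (∀ n → HasDegree (Q n) n) →
               ∃[ L ] IsLah P Q L
  lah-exists P Q degP degQ =
    (λ n → proj₁ (e n)) , (λ n → expansion⇒≈ₚ Q n (P n) (e n)) , (λ {n} → proj₂ (proj₂ (e n)))
    where
    e : ∀ n → Expansion Q (suc n) (P n)
    e n = expand Q degQ (suc n) (P n) (proj₂ (degP n))

{-# OPTIONS --safe #-}
module Submission where

-- Expanding x^n in the basis P_k, and then each P_k(x,j) in the basis P_h,
-- gives x^n = Σ_m (Σ_j L_{k,h,j}^m D_{k,n}^j) P_h(x,m).  Polynomials of
-- distinct degrees are linearly independent, so the inner sum is D_{h,n}^m.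
-- Summing over m and exchanging the two sums gives the formula.

open import Defs
open import Algebra.Apartness.Bundles using (HeytingField)
import Algebra.Apartness.Properties.HeytingCommutativeRing as HeytingProperties
import Algebra.Definitions.RawMonoid as RawMonoidDefs
import Algebra.Properties.Group as GroupProperties
import Algebra.Properties.Semiring.Sum as SemiringSum
open import Data.Fin.Base using (Fin; zero; suc; toℕ; fromℕ; inject₁)
open import Data.Fin.Properties using (toℕ-fromℕ; toℕ-inject₁; toℕ<n; inject₁ℕ<)
open import Data.Fin.Relation.Unary.Top using (View; view; ‵fromℕ; ‵inject₁)
open import Data.List.Base using ([]; _∷_)
open import Data.Nat.Base using (ℕ; zero; suc; _≤_; _<_; z≤n; s≤s)
open import Data.Product.Base using (_,_; proj₁; proj₂)
open import Data.Vec.Functional using (Vector)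
open import Function.Base using (_∘_)
import Relation.Binary.PropositionalEquality.Core as ≡
open import Relation.Binary.PropositionalEquality.Core using (_≢_)
import Relation.Binary.Reasoning.Setoid as SetoidReasoning

module _ {c ℓ₁ ℓ₂} (F : HeytingField c ℓ₁ ℓ₂) where

  open Polynomials F
  open HeytingField F using (heytingCommutativeRing; #⇒invertible)
  open HeytingProperties heytingCommutativeRing using (x-0≈x)
  open GroupProperties +-group using () renaming (∙-cancelʳ to +-cancelʳ)
  open SemiringSum semiring
    using (sum-cong-≋; sum-init-last; sum-replicate-zero; ∑-comm; *-distribˡ-sum; *-distribʳ-sum)
  open SetoidReasoning setoid

  -- Serves to divide by leading coefficients: `HasDegree` makes them apart from `0#`, and apartness
  -- provides an inverse.
  *-cancelʳ-# : ∀ {x y z} → z # 0# → x * z ≈ y * z → x ≈ y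
  *-cancelʳ-# {x} {y} {z} z#0 xz≈yz = begin
    x              ≈⟨ divide x ⟨
    x * z * z⁻¹    ≈⟨ *-congʳ xz≈yz ⟩
    y * z * z⁻¹    ≈⟨ divide y ⟩
    y              ∎
    where
    z⁻¹ = proj₁ (#⇒invertible z#0)

    divide : ∀ w → w * z * z⁻¹ ≈ w
    divide w = begin
      w * z * z⁻¹            ≈⟨ *-assoc w z z⁻¹ ⟩
      -- `#⇒invertible` inverts the difference of the two apart elements, so `z⁻¹` is stated to be
      -- the inverse of `z - 0#`.
      w * (z * z⁻¹)          ≈⟨ *-congˡ (*-congʳ (x-0≈x z)) ⟨
      w * ((z - 0#) * z⁻¹)   ≈⟨ *-congˡ (proj₂ (proj₂ (#⇒invertible z#0))) ⟩
      w * 1#                 ≈⟨ *-identityʳ w ⟩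
      w                      ∎

  sum-zero : ∀ {n} {f : Vector Carrier n} → (∀ j → f j ≈ 0#) → sum f ≈ 0#
  sum-zero {n} f≈0 = trans (sum-cong-≋ f≈0) (sum-replicate-zero n)

  -- The terms added from `m` onwards all vanish. This brings the expansions of all `P (toℕ j)` to
  -- the common bound `n`, so that the double sum runs over a square and its order can be exchanged.
  sum-extend : ∀ (f : ℕ → Carrier) {m n} → m ≤ n → (∀ {j} → m ≤ j → f j ≈ 0#) →
               sum {m} (f ∘ toℕ) ≈ sum {n} (f ∘ toℕ)
  sum-extend f {n = n} z≤n   f≈0 = sym (sum-zero {n} {f ∘ toℕ} (λ _ → f≈0 z≤n))
  sum-extend f (s≤s m≤n)     f≈0 = +-congˡ (sum-extend (f ∘ suc) m≤n (f≈0 ∘ s≤s))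

  coeff-+ₚ : ∀ p q i → coeff (p +ₚ q) i ≈ coeff p i + coeff q i
  coeff-+ₚ []      q       i       = sym (+-identityˡ _)
  coeff-+ₚ (a ∷ p) []      i       = sym (+-identityʳ _)
  coeff-+ₚ (a ∷ p) (b ∷ q) zero    = refl
  coeff-+ₚ (a ∷ p) (b ∷ q) (suc i) = coeff-+ₚ p q i

  coeff-·ₚ : ∀ a p i → coeff (a ·ₚ p) i ≈ a * coeff p i
  coeff-·ₚ a []      i       = sym (zeroʳ a)
  coeff-·ₚ a (b ∷ p) zero    = refl
  coeff-·ₚ a (b ∷ p) (suc i) = coeff-·ₚ a p i

  -- Taking coefficients is linear. Polynomial identities thereby become scalar sums, one for each
  -- degree `i`, to which the semiring sum laws apply.
  coeff-combination : ∀ {n} (a : Vector Carrier n) (R : Vector Polynomial n) i →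
    coeff (RawMonoidDefs.sum +ₚ-rawMonoid (λ j → a j ·ₚ R j)) i ≈
    sum (λ j → a j * coeff (R j) i)
  coeff-combination {zero}  a R i = refl
  coeff-combination {suc n} a R i = trans (coeff-+ₚ (a zero ·ₚ R zero) _ i)
    (+-cong (coeff-·ₚ (a zero) (R zero) i) (coeff-combination (a ∘ suc) (R ∘ suc) i))

  -- Only the last polynomial contributes to the coefficient of the top degree.
  combination-unique : ∀ {n} (R : Vector Polynomial n) → (∀ j → HasDegree (R j) (toℕ j)) →
    (a b : Vector Carrier n) →
    (∀ i → sum (λ j → a j * coeff (R j) i) ≈ sum (λ j → b j * coeff (R j) i)) →
    ∀ j → a j ≈ b j
  combination-unique {suc n} R deg a b eq = λ j → split j (view j)
    where
    top = fromℕ n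

    term : Vector Carrier (suc n) → ℕ → Vector Carrier (suc n)
    term a i j = a j * coeff (R j) i

    inject₁<top : (j : Fin n) → toℕ (inject₁ j) < toℕ top
    inject₁<top j = ≡.subst (toℕ (inject₁ j) <_) (≡.sym (toℕ-fromℕ n)) (inject₁ℕ< j)

    sum-top : ∀ a → sum (term a (toℕ top)) ≈ term a (toℕ top) top
    sum-top a = begin
      sum (term a (toℕ top))
        ≈⟨ sum-init-last (term a (toℕ top)) ⟩
      sum (term a (toℕ top) ∘ inject₁) + term a (toℕ top) top
        ≈⟨ +-congʳ (sum-zero (λ j → trans (*-congˡ (proj₂ (deg (inject₁ j)) (inject₁<top j))) (zeroʳ _))) ⟩
      0# + term a (toℕ top) top
        ≈⟨ +-identityˡ _ ⟩
      term a (toℕ top) top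
        ∎

    a≈b-top : a top ≈ b top
    a≈b-top = *-cancelʳ-# (proj₁ (deg top))
      (trans (sym (sum-top a)) (trans (eq (toℕ top)) (sum-top b)))

    -- With the top coefficients equal, their terms cancel in every degree `i`, so the shorter
    -- families again satisfy the hypothesis and the induction on length goes through.
    lower : ∀ i → sum (term a i ∘ inject₁) ≈ sum (term b i ∘ inject₁)
    lower i = +-cancelʳ (term b i top) _ _ (begin
      sum (term a i ∘ inject₁) + term b i top    ≈⟨ +-congˡ (*-congʳ a≈b-top) ⟨
      sum (term a i ∘ inject₁) + term a i top    ≈⟨ sum-init-last (term a i) ⟨
      sum (term a i)                             ≈⟨ eq i ⟩
      sum (term b i)                             ≈⟨ sum-init-last (term b i) ⟩
      sum (term b i ∘ inject₁) + term b i top    ∎)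

    split : ∀ j → View j → a j ≈ b j
    split _ ‵fromℕ       = a≈b-top
    split _ (‵inject₁ j) = combination-unique (R ∘ inject₁)
      -- `toℕ (inject₁ j)` equals `toℕ j` only propositionally, so the degree has to be transported.
      (λ j → ≡.subst (HasDegree (R (inject₁ j))) (toℕ-inject₁ j) (deg (inject₁ j)))
      (a ∘ inject₁) (b ∘ inject₁) lower j

  stirling₂-change-basis : ∀ P Q D E L → (∀ n → HasDegree (Q n) n) →
    IsStirling₂ P D → IsStirling₂ Q E → IsLah P Q L →
    ∀ n m → E n m ≈ ∑[ j ≤ n ] (L (toℕ j) (toℕ m) * D n j)
  stirling₂-change-basis P Q D E L degQ stirP stirQ (lah , L≈0) n =
    combination-unique (Q ∘ toℕ) (λ m → degQ (toℕ m)) (E n) _ (λ i → begin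
      ∑[ m ≤ n ] (E n m * q i m)
        ≈⟨ coeff-combination (E n) (Q ∘ toℕ) i ⟨
      coeff (∑ₚ[ m ≤ n ] (E n m ·ₚ Q (toℕ m))) i
        ≈⟨ stirQ n i ⟨
      coeff (X^ n) i
        ≈⟨ stirP n i ⟩
      coeff (∑ₚ[ j ≤ n ] (D n j ·ₚ P (toℕ j))) i
        ≈⟨ coeff-combination (D n) (P ∘ toℕ) i ⟩
      ∑[ j ≤ n ] (D n j * coeff (P (toℕ j)) i)
        ≈⟨ sum-cong-≋ (λ j → *-congˡ {D n j} (coeff-P i j)) ⟩
      ∑[ j ≤ n ] (D n j * (∑[ m ≤ n ] (L (toℕ j) (toℕ m) * q i m)))
        ≈⟨ sum-cong-≋ (λ j → *-distribˡ-sum (D n j) (λ m → L (toℕ j) (toℕ m) * q i m)) ⟩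
      ∑[ j ≤ n ] (∑[ m ≤ n ] (D n j * (L (toℕ j) (toℕ m) * q i m)))
        ≈⟨ ∑-comm (λ j m → D n j * (L (toℕ j) (toℕ m) * q i m)) ⟩
      ∑[ m ≤ n ] (∑[ j ≤ n ] (D n j * (L (toℕ j) (toℕ m) * q i m)))
        -- Commutativity moves `q i m`, which does not depend on `j`, to the far right, where it
        -- factors out of the inner sum.
        ≈⟨ sum-cong-≋ (λ m → sum-cong-≋ (λ j → regroup (D n j) (L (toℕ j) (toℕ m)) (q i m))) ⟩
      ∑[ m ≤ n ] (∑[ j ≤ n ] (L (toℕ j) (toℕ m) * D n j * q i m))
        ≈⟨ sum-cong-≋ (λ m → *-distribʳ-sum (q i m) (λ j → L (toℕ j) (toℕ m) * D n j)) ⟨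
      ∑[ m ≤ n ] ((∑[ j ≤ n ] (L (toℕ j) (toℕ m) * D n j)) * q i m)
        ∎)
    where
    q : ℕ → Vector Carrier (suc n)
    q i m = coeff (Q (toℕ m)) i

    regroup : ∀ x y z → x * (y * z) ≈ y * x * z
    regroup x y z = trans (sym (*-assoc x y z)) (*-congʳ (*-comm x y))

    coeff-P : ∀ i (j : Fin (suc n)) →
              coeff (P (toℕ j)) i ≈ ∑[ m ≤ n ] (L (toℕ j) (toℕ m) * q i m)
    coeff-P i j = begin
      coeff (P (toℕ j)) i
        ≈⟨ lah (toℕ j) i ⟩
      coeff (∑ₚ[ m ≤ toℕ j ] (L (toℕ j) (toℕ m) ·ₚ Q (toℕ m))) i
        ≈⟨ coeff-combination {suc (toℕ j)} (L (toℕ j) ∘ toℕ) (Q ∘ toℕ) i ⟩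
      ∑[ m ≤ toℕ j ] (L (toℕ j) (toℕ m) * coeff (Q (toℕ m)) i)
        -- The two sums have `suc (toℕ j)` and `suc n` terms, and `toℕ j < suc n` unfolds to the
        -- required inequality of lengths. The new terms have `m` above `toℕ j`, where the
        -- convention makes the Lah number zero.
        ≈⟨ sum-extend (λ m → L (toℕ j) m * coeff (Q m) i) (toℕ<n j)
             (λ j<m → trans (*-congʳ (L≈0 j<m)) (zeroˡ _)) ⟩
      ∑[ m ≤ n ] (L (toℕ j) (toℕ m) * q i m)
        ∎

  ∑-stirling₂-change-basis : ∀ P Q D E L → (∀ n → HasDegree (Q n) n) →
    IsStirling₂ P D → IsStirling₂ Q E → IsLah P Q L →
    ∀ n → ∑[ m ≤ n ] E n m ≈ ∑[ j ≤ n ] ((∑[ m ≤ n ] L (toℕ j) (toℕ m)) * D n j)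
  ∑-stirling₂-change-basis P Q D E L degQ stirP stirQ lah n = begin
    ∑[ m ≤ n ] E n m
      ≈⟨ sum-cong-≋ (stirling₂-change-basis P Q D E L degQ stirP stirQ lah n) ⟩
    ∑[ m ≤ n ] (∑[ j ≤ n ] (L (toℕ j) (toℕ m) * D n j))
      ≈⟨ ∑-comm {suc n} (λ m j → L (toℕ j) (toℕ m) * D n j) ⟩
    ∑[ j ≤ n ] (∑[ m ≤ n ] (L (toℕ j) (toℕ m) * D n j))
      -- After the exchange, `D n j` is constant in the inner index `m`.
      ≈⟨ sum-cong-≋ (λ j → *-distribʳ-sum {suc n} (D n j) (L (toℕ j) ∘ toℕ)) ⟨
    ∑[ j ≤ n ] ((∑[ m ≤ n ] L (toℕ j) (toℕ m)) * D n j)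
      ∎

mainTheorem4 : ∀ {c ℓ₁ ℓ₂} (F : HeytingField c ℓ₁ ℓ₂) →
    let open Polynomials F in
    CharacteristicZero →
    (P : Fin 2 → ℕ → Polynomial) →
    (∀ k n → HasDegree (P k n) n) →
    (D : Fin 2 → ∀ n → Vector Carrier (suc n)) →
    (∀ k → IsStirling₂ (P k) (D k)) →
    (L : Fin 2 → Fin 2 → ℕ → ℕ → Carrier) →
    (∀ k h → k ≢ h → IsLah (P k) (P h) (L k h)) →
    ∀ k h → k ≢ h → ∀ n →
    let B = ∑[ m ≤ n ] D h n m in
    B ≈ ∑[ j ≤ n ] ((∑[ m ≤ n ] L k h (toℕ j) (toℕ m)) * D k n j)
mainTheorem4 F _ P deg D stirling L lah k h k≢h =
  -- `P h` is the basis in which coefficients are compared, hence `deg h`.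
  ∑-stirling₂-change-basis F (P k) (P h) (D k) (D h) (L k h) (deg h) (stirling k) (stirling h) (lah k h k≢h)
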